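{- Let $T$ be a finite tree all of whose vertices have odd degree, and run majority dynamics on $T$ from an arbitrary $\xi_0\in\{ -1,1\}^{V(T)}$. Call a vertex $w$ active if fewer than $\frac12(\deg_T w-1)$ of its neighbours are leaves. Let $v$ be an active vertex and let $t$ be the number of vertices in a longest path of $T$ that starts at $v$ and consists only of active vertices. Then $v$ is $t$-stable.
   Context: Majority dynamics: for $t\ge1$ and every vertex $i$, $\xi_t(i)=\mathrm{sign}\sum_{j\in N_T(i)}\xi_{t-1}(j)$. For $t\in\mathbb{Z}_{\ge0}$, a vertex $u$ is $t$-stable if $\xi_s(u)=\xi_{s+2}(u)$ for every $s\ge t$ with the same parity as $t$. -}

module Defs where

open import Data.Nat using (ℕ; zero; suc; _+_; _*_; _∸_; _≤_; _<_; _%_)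
open import Data.Fin using (Fin)
open import Data.Bool using (Bool; true; false)
open import Data.List using (List; []; _∷_; _++_; length; filterᵇ; foldr; map; head)
open import Data.List.Relation.Unary.Linked using (Linked)
open import Data.List.Relation.Unary.All using (All)
open import Data.List.Relation.Unary.Unique.Propositional using (Unique)
open import Data.Maybe using (Maybe; just)
open import Data.Integer using (ℤ; _◃_) renaming (_+_ to _+ℤ_; sign to signℤ)
open import Data.Sign using (Sign)
open import Data.Product using (Σ; _×_; ∃)
open import Data.Fin using () renaming (toℕ to finToℕ)
open import Data.List using (allFin; last)
open import Relation.Binary.PropositionalEquality using (_≡_)
open import Relation.Nullary using (¬_)

-- A simple graph on vertex set Fin n (symmetric, loopless adjacency).
record Graph (n : ℕ) : Set where
  field
    adj    : Fin n → Fin n → Bool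
    adj-sym    : ∀ i j → adj i j ≡ adj j i
    adj-irrefl : ∀ i → adj i i ≡ false
open Graph public

module _ {n : ℕ} (G : Graph n) where

  Adj : Fin n → Fin n → Set
  Adj i j = adj G i j ≡ true

  -- neighbourhood N_G(i) as a list of distinct vertices
  nbrs : Fin n → List (Fin n)
  nbrs i = filterᵇ (adj G i) (allFin n)

  deg : Fin n → ℕ
  deg i = length (nbrs i)

  -- a path: a list of pairwise distinct vertices, consecutive ones adjacent
  IsPath : List (Fin n) → Set
  IsPath p = Unique p × Linked Adj p

  Connected : Set
  Connected = ∀ u v → ∃ λ p → IsPath p × head p ≡ just u × last p ≡ just v

  -- no cycle x, y₁, …, yₖ, y (k ≥ 1) with y adjacent to x
  Acyclic : Set
  Acyclic = ∀ x ys y → IsPath (x ∷ ys ++ y ∷ []) → 1 ≤ length ys → ¬ Adj y x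

  IsTree : Set
  IsTree = Connected × Acyclic

  AllDegreesOdd : Set
  AllDegreesOdd = ∀ i → deg i % 2 ≡ 1

  IsLeaf : Fin n → Set
  IsLeaf i = deg i ≡ 1

  isLeafᵇ : Fin n → Bool
  isLeafᵇ i with deg i
  ... | 1 = true
  ... | _ = false

  leafNbrCount : Fin n → ℕ
  leafNbrCount w = length (filterᵇ isLeafᵇ (nbrs w))

  -- active: fewer than (deg w - 1)/2 neighbours are leaves, i.e. 2·L < deg w - 1
  Active : Fin n → Set
  Active w = 2 * leafNbrCount w < deg w ∸ 1

  -- t is the number of vertices of a longest path starting at v consisting of active vertices
  ActivePathFrom : Fin n → List (Fin n) → Set
  ActivePathFrom v p = IsPath p × head p ≡ just v × All Active p

  IsLongestActivePathLength : Fin n → ℕ → Set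
  IsLongestActivePathLength v t =
    (∃ λ p → ActivePathFrom v p × length p ≡ t) ×
    (∀ p → ActivePathFrom v p → length p ≤ t)

  Config : Set
  Config = Fin n → Sign

  -- ξ_t(i) = sign Σ_{j ∈ N(i)} ξ_{t-1}(j)   (sum is odd, hence nonzero, when deg i is odd)
  step : Config → Config
  step ξ i = signℤ (foldr _+ℤ_ (ℤ.pos 0) (map (λ j → ξ j ◃ 1) (nbrs i)))

  majority : Config → ℕ → Config
  majority ξ₀ zero    = ξ₀
  majority ξ₀ (suc t) = step (majority ξ₀ t)

  -- u is t-stable: ξ_s(u) = ξ_{s+2}(u) for every s ≥ t with s ≡ t (mod 2)
  Stable : Config → ℕ → Fin n → Set
  Stable ξ₀ t u = ∀ s → t ≤ s → s % 2 ≡ t % 2 → majority ξ₀ s u ≡ majority ξ₀ (2 + s) u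

-- Suppose ξ_s(v) ≠ ξ_{s+2}(v) for some s ≥ t, and put c = ξ_s(v). As ξ_s(v) and ξ_{s+2}(v)
-- are the majorities of the neighbours of v at times s−1 and s+1, and majority is monotone,
-- some neighbour u has ξ_{s−1}(u) = c ≠ ξ_{s+1}(u): the instability of v at time s is caused
-- by an instability of u at time s−1. Iterating gives a walk v = p₀, p₁, …, p_s with p_i
-- unstable at time s−i. The walk never backtracks, because p_{i−1} shows at time s−i+1 the
-- value that p_{i+1} loses then; so in a tree it is a path. Every p_{i+1} is active: its
-- leaf neighbours copy its value c' from time s−i−1, and so does p_i at time s−i, yet the
-- majority of its neighbours turns against c', so fewer than half of them can be leaves.
-- This path of s+1 > t active vertices contradicts the maximality of t.

module Submission where

open import Defs
open import Data.Nat using (ℕ)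
open import Data.Fin using (Fin)

open import Data.Bool using (Bool; true; false)
open import Data.Bool.Properties using (T-≡)
open import Data.Integer as ℤ using (ℤ; +_; -[1+_]; _◃_; _⊖_; +≤+; -≤+; -≤-)
  renaming (_+_ to _+ℤ_; sign to signℤ)
import Data.Integer.Properties as ℤP
open import Data.List using (List; []; _∷_; _++_; length; filter; filterᵇ; foldr; map; allFin)
open import Data.List.Properties using (++-assoc; filter-accept)
open import Data.List.Membership.Propositional using (_∈_; _∉_; find)
open import Data.List.Membership.Propositional.Properties
  using (∈-filter⁺; ∈-filter⁻; ∈-allFin; ∈-∃++)
open import Data.List.Relation.Unary.All as All using (All; []; _∷_)
import Data.List.Relation.Unary.All.Properties as AllP
open import Data.List.Relation.Unary.Any using (here; there; any?)
open import Data.List.Relation.Unary.Linked using (Linked; []; [-]; _∷_)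
open import Data.List.Relation.Unary.AllPairs using ([]; _∷_)
open import Data.List.Relation.Unary.Unique.Propositional using (Unique)
open import Data.Nat using (zero; suc; _+_; _*_; _∸_; _≤_; _<_; z≤n; s≤s; _≤?_)
import Data.Nat.Properties as ℕP
open import Data.Product using (∃; _×_; _,_; proj₂)
open import Data.Sign as Sign using (Sign) renaming (_≟_ to _≟ₛ_)
open import Function using (_∘_)
open import Function.Bundles using (Equivalence)
open import Relation.Binary.PropositionalEquality
open import Relation.Nullary using (¬_; yes; no; contradiction)
open import Relation.Nullary.Decidable using (_×-dec_; ¬?; T?; decidable-stable)

2*≤+ : ∀ {m n} → m ≤ n → 2 * m ≤ m + n
2*≤+ {m} m≤n = ℕP.+-monoʳ-≤ m (subst (_≤ _) (sym (ℕP.+-identityʳ m)) m≤n)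

2*suc≤⇒<∸1 : ∀ l d → 2 * suc l ≤ d → 2 * l < d ∸ 1
2*suc≤⇒<∸1 l (suc d) le = ℕP.≤-pred (subst (_≤ suc d) (ℕP.*-suc 2 l) le)

sign-⊖≢+⇒< : ∀ m n → signℤ (m ⊖ n) ≢ Sign.+ → m < n
sign-⊖≢+⇒< m n s≢+ with n ≤? m
... | yes n≤m = contradiction (cong signℤ (ℤP.⊖-≥ n≤m)) s≢+
... | no n≰m  = ℕP.≰⇒> n≰m

sign-⊖≢-⇒≥ : ∀ m n → signℤ (m ⊖ n) ≢ Sign.- → n ≤ m
sign-⊖≢-⇒≥ m n s≢- with n ≤? m
... | yes n≤m = n≤m
... | no n≰m  = contradiction (ℤP.sign-⊖-≰ n≰m) s≢-

sign≡+-mono : ∀ {i j} → i ℤ.≤ j → signℤ i ≡ Sign.+ → signℤ j ≡ Sign.+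
sign≡+-mono (+≤+ _) _ = refl
sign≡+-mono -≤+     _ = refl
sign≡+-mono (-≤- _) ()

◃1-mono : ∀ {s t} → (s ≡ Sign.+ → t ≡ Sign.+) → s ◃ 1 ℤ.≤ t ◃ 1
◃1-mono {Sign.+} {Sign.+} _ = ℤP.≤-refl
◃1-mono {Sign.-} {Sign.+} _ = -≤+
◃1-mono {Sign.-} {Sign.-} _ = ℤP.≤-refl
◃1-mono {Sign.+} {Sign.-} s⇒t with () ← s⇒t refl

≡-⇒≡-⇒≡+⇒≡+ : ∀ {s t} → (s ≡ Sign.- → t ≡ Sign.-) → t ≡ Sign.+ → s ≡ Sign.+
≡-⇒≡-⇒≡+⇒≡+ {Sign.+} _ _       = refl
≡-⇒≡-⇒≡+⇒≡+ {Sign.-} s⇒t refl with () ← s⇒t refl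

∈-length≡1 : ∀ {A : Set} {u : A} {l} → u ∈ l → length l ≡ 1 → l ≡ u ∷ []
∈-length≡1 {l = _ ∷ []} (here refl) _ = refl

Linked-++⁻ˡ : ∀ {A : Set} {R : A → A → Set} xs {ys} → Linked R (xs ++ ys) → Linked R xs
Linked-++⁻ˡ []           _        = []
Linked-++⁻ˡ (_ ∷ [])     _        = [-]
Linked-++⁻ˡ (_ ∷ y ∷ xs) (r ∷ rs) = r ∷ Linked-++⁻ˡ (y ∷ xs) rs

Unique-++⁻ˡ : ∀ {A : Set} (xs : List A) {ys} → Unique (xs ++ ys) → Unique xs
Unique-++⁻ˡ []       _          = []
Unique-++⁻ˡ (_ ∷ xs) (x∉ ∷ uxs) = AllP.++⁻ˡ xs x∉ ∷ Unique-++⁻ˡ xs uxs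

module _ {A : Set} where

  -- step G ξ i unfolds to signℤ (signedSum ξ (nbrs G i)).
  signedSum : (A → Sign) → List A → ℤ
  signedSum Y l = foldr _+ℤ_ (+ 0) (map (λ x → Y x ◃ 1) l)

  count : Sign → (A → Sign) → List A → ℕ
  count c Y l = length (filter (λ x → Y x ≟ₛ c) l)

  count-accept : ∀ {c Y x} xs → Y x ≡ c → count c Y (x ∷ xs) ≡ suc (count c Y xs)
  count-accept {c} {Y} _ Yx≡c = cong length (filter-accept (λ x → Y x ≟ₛ c) Yx≡c)

  count-∷-≥ : ∀ c Y x xs → count c Y xs ≤ count c Y (x ∷ xs)
  count-∷-≥ c Y x xs with Y x ≟ₛ c
  ... | yes _ = ℕP.n≤1+n _
  ... | no _  = ℕP.≤-refl

  signedSum≡count⊖count : ∀ Y l → signedSum Y l ≡ count Sign.+ Y l ⊖ count Sign.- Y l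
  signedSum≡count⊖count Y []       = refl
  signedSum≡count⊖count Y (x ∷ xs) with Y x
  ... | Sign.+ = trans (cong (+ 1 +ℤ_) (signedSum≡count⊖count Y xs))
                       (ℤP.distribʳ-⊖-+-pos 1 (count Sign.+ Y xs) (count Sign.- Y xs))
  ... | Sign.- = trans (cong (-[1+ 0 ] +ℤ_) (signedSum≡count⊖count Y xs))
                       (ℤP.distribʳ-⊖-+-neg 0 (count Sign.+ Y xs) (count Sign.- Y xs))

  count+count≡length : ∀ Y l → count Sign.+ Y l + count Sign.- Y l ≡ length l
  count+count≡length Y []       = refl
  count+count≡length Y (x ∷ xs) with Y x
  ... | Sign.+ = cong suc (count+count≡length Y xs)
  ... | Sign.- = trans (ℕP.+-suc _ _) (cong suc (count+count≡length Y xs))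

  sign≢⇒2*count≤length : ∀ c Y l → signℤ (signedSum Y l) ≢ c → 2 * count c Y l ≤ length l
  sign≢⇒2*count≤length Sign.+ Y l s≢+ =
    subst (2 * #+ ≤_) (count+count≡length Y l)
      (2*≤+ (ℕP.<⇒≤ (sign-⊖≢+⇒< #+ #- (subst (λ i → signℤ i ≢ Sign.+) (signedSum≡count⊖count Y l) s≢+))))
    where #+ = count Sign.+ Y l; #- = count Sign.- Y l
  sign≢⇒2*count≤length Sign.- Y l s≢- =
    subst (2 * #- ≤_) (trans (ℕP.+-comm #- #+) (count+count≡length Y l))
      (2*≤+ (sign-⊖≢-⇒≥ #+ #- (subst (λ i → signℤ i ≢ Sign.-) (signedSum≡count⊖count Y l) s≢-)))
    where #+ = count Sign.+ Y l; #- = count Sign.- Y l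

  signedSum-mono : ∀ {a b : A → Sign} {l} → All (λ x → a x ≡ Sign.+ → b x ≡ Sign.+) l →
                   signedSum a l ℤ.≤ signedSum b l
  signedSum-mono []         = ℤP.≤-refl
  signedSum-mono (a⇒b ∷ ps) = ℤP.+-mono-≤ (◃1-mono a⇒b) (signedSum-mono ps)

  sign-signedSum-preserved : ∀ c (a b : A → Sign) l → All (λ x → a x ≡ c → b x ≡ c) l →
                             signℤ (signedSum a l) ≡ c → signℤ (signedSum b l) ≡ c
  sign-signedSum-preserved Sign.+ a b l a⇒b = sign≡+-mono (signedSum-mono a⇒b)
  sign-signedSum-preserved Sign.- a b l a⇒b sa with signℤ (signedSum b l) in sb
  ... | Sign.- = refl
  ... | Sign.+ with () ← trans (sym sa) (sign≡+-mono (signedSum-mono (All.map ≡-⇒≡-⇒≡+⇒≡+ a⇒b)) sb)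

  sign-deviation : ∀ c (a b : A → Sign) l → signℤ (signedSum a l) ≡ c → signℤ (signedSum b l) ≢ c →
                   ∃ λ x → x ∈ l × a x ≡ c × b x ≢ c
  sign-deviation c a b l sa sb with any? (λ x → (a x ≟ₛ c) ×-dec ¬? (b x ≟ₛ c)) l
  ... | yes deviant = find deviant
  ... | no ¬deviant =
    contradiction (sign-signedSum-preserved c a b l (All.map a⇒b (AllP.¬Any⇒All¬ l ¬deviant)) sa) sb
    where
    a⇒b : ∀ {x} → ¬ (a x ≡ c × b x ≢ c) → a x ≡ c → b x ≡ c
    a⇒b {x} ¬dev ax≡c = decidable-stable (b x ≟ₛ c) (λ bx≢c → ¬dev (ax≡c , bx≢c))

  length-filterᵇ≤count : ∀ (f : A → Bool) c Y l → (∀ {x} → x ∈ l → f x ≡ true → Y x ≡ c) →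
                         length (filterᵇ f l) ≤ count c Y l
  length-filterᵇ≤count f c Y []       _   = z≤n
  length-filterᵇ≤count f c Y (x ∷ xs) f⇒Y with f x in fx
  ... | true  = subst (suc (length (filterᵇ f xs)) ≤_) (sym (count-accept xs (f⇒Y (here refl) fx)))
                      (s≤s (length-filterᵇ≤count f c Y xs (f⇒Y ∘ there)))
  ... | false = ℕP.≤-trans (length-filterᵇ≤count f c Y xs (f⇒Y ∘ there)) (count-∷-≥ c Y x xs)

  length-filterᵇ<count : ∀ (f : A → Bool) c Y {w} l → w ∈ l → f w ≡ false → Y w ≡ c →
                         (∀ {x} → x ∈ l → f x ≡ true → Y x ≡ c) →
                         length (filterᵇ f l) < count c Y l
  length-filterᵇ<count f c Y (_ ∷ xs) (here refl) fw Yw f⇒Y rewrite fw =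
    subst (suc (length (filterᵇ f xs)) ≤_) (sym (count-accept xs Yw))
          (s≤s (length-filterᵇ≤count f c Y xs (f⇒Y ∘ there)))
  length-filterᵇ<count f c Y (x ∷ xs) (there w∈) fw Yw f⇒Y with f x in fx
  ... | true  = subst (suc (suc (length (filterᵇ f xs))) ≤_) (sym (count-accept xs (f⇒Y (here refl) fx)))
                      (s≤s (length-filterᵇ<count f c Y xs w∈ fw Yw (f⇒Y ∘ there)))
  ... | false = ℕP.<-≤-trans (length-filterᵇ<count f c Y xs w∈ fw Yw (f⇒Y ∘ there))
                             (count-∷-≥ c Y x xs)

module _ {n : ℕ} (G : Graph n) where

  ∈-nbrs⇒Adj : ∀ {w u} → u ∈ nbrs G w → Adj G w u
  ∈-nbrs⇒Adj {w} u∈ = Equivalence.to T-≡ (proj₂ (∈-filter⁻ (T? ∘ adj G w) {xs = allFin n} u∈))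

  Adj⇒∈-nbrs : ∀ {w u} → Adj G w u → u ∈ nbrs G w
  Adj⇒∈-nbrs {w} {u} w~u = ∈-filter⁺ (T? ∘ adj G w) (∈-allFin u) (Equivalence.from T-≡ w~u)

  Adj-sym : ∀ {w u} → Adj G w u → Adj G u w
  Adj-sym {w} {u} = trans (adj-sym G u w)

  Adj⇒≢ : ∀ {w u} → Adj G w u → w ≢ u
  Adj⇒≢ {w} w~w refl with () ← trans (sym w~w) (adj-irrefl G w)

  isLeafᵇ⇒IsLeaf : ∀ ℓ → isLeafᵇ G ℓ ≡ true → IsLeaf G ℓ
  isLeafᵇ⇒IsLeaf ℓ with deg G ℓ
  ... | 1 = λ _ → refl
  ... | 0 = λ ()
  ... | suc (suc _) = λ ()

  Active⇒¬isLeafᵇ : ∀ w → Active G w → isLeafᵇ G w ≡ false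
  Active⇒¬isLeafᵇ w with deg G w
  ... | 0 = λ _ → refl
  ... | 1 = λ ()
  ... | suc (suc _) = λ _ → refl

  step-leaf : ∀ (Y : Config G) {u ℓ} → ℓ ∈ nbrs G u → isLeafᵇ G ℓ ≡ true → step G Y ℓ ≡ Y u
  step-leaf Y {u} {ℓ} ℓ∈ leaf = begin
    signℤ (signedSum Y (nbrs G ℓ))  ≡⟨ cong (signℤ ∘ signedSum Y) nbrs≡ ⟩
    signℤ ((Y u ◃ 1) +ℤ + 0)        ≡⟨ cong signℤ (ℤP.+-identityʳ (Y u ◃ 1)) ⟩
    signℤ (Y u ◃ 1)                 ≡⟨ ℤP.sign-◃ (Y u) 1 ⟩
    Y u                             ∎
    where
    open ≡-Reasoning
    nbrs≡ = ∈-length≡1 (Adj⇒∈-nbrs (Adj-sym (∈-nbrs⇒Adj ℓ∈))) (isLeafᵇ⇒IsLeaf ℓ leaf)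

  Active-if-unsettled : ∀ (Y : Config G) c {u w} → Y u ≡ c → step G (step G Y) u ≢ c →
                        w ∈ nbrs G u → step G Y w ≡ c → Active G w → Active G u
  Active-if-unsettled Y c {u} {w} Yu≡c flips w∈ Zw≡c active-w =
    2*suc≤⇒<∸1 (leafNbrCount G u) (deg G u)
      (ℕP.≤-trans (ℕP.*-monoʳ-≤ 2 leaves<count) (sign≢⇒2*count≤length c Z (nbrs G u) flips))
    where
    Z = step G Y
    leaves<count = length-filterᵇ<count (isLeafᵇ G) c Z (nbrs G u) w∈
                     (Active⇒¬isLeafᵇ w active-w) Zw≡c (λ ℓ∈ leaf → trans (step-leaf Y ℓ∈ leaf) Yu≡c)

  ∷-IsPath : ∀ {q w u p} → Acyclic G → Adj G q w → u ≢ q →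
             IsPath G (w ∷ u ∷ p) → IsPath G (q ∷ w ∷ u ∷ p)
  ∷-IsPath {q} {w} {u} {p} acyclic q~w u≢q (unique , linked) =
    (AllP.¬Any⇒All¬ _ q∉ ∷ unique) , (q~w ∷ linked)
    where
    q∉ : q ∉ w ∷ u ∷ p
    q∉ (here q≡w)          = Adj⇒≢ q~w q≡w
    q∉ (there (here q≡u))  = u≢q (sym q≡u)
    q∉ (there (there q∈p)) with ∈-∃++ q∈p
    ... | as , bs , refl = acyclic w (u ∷ as) q (Unique-++⁻ˡ cycle unique′ , Linked-++⁻ˡ cycle linked′)
                                   (s≤s z≤n) q~w
      where
      cycle = w ∷ u ∷ as ++ q ∷ []
      split = ++-assoc (w ∷ u ∷ as) (q ∷ []) bs
      unique′ = subst Unique (sym split) unique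
      linked′ = subst (Linked (Adj G)) (sym split) linked

  module Dynamics (ξ₀ : Config G) where

    X : ℕ → Config G
    X = majority G ξ₀

    Unsettled : ℕ → Fin n → Set
    Unsettled k w = X k w ≢ X (2 + k) w

    -- An edge p_i → p_{i+1} of the walk in the proof idea, where k = s − i − 1.
    Culprit : ℕ → Fin n → Fin n → Set
    Culprit k q w = Adj G q w × Active G w × X (suc k) q ≡ X k w × Unsettled k w

    unsettled-culprit : ∀ {k w} → Active G w → Unsettled (suc k) w →
                        ∃ λ u → Culprit k w u × X (2 + k) u ≢ X (suc k) w
    unsettled-culprit {k} {w} active-w unsettled
      with sign-deviation (X (suc k) w) (X k) (X (2 + k)) (nbrs G w) refl (unsettled ∘ sym)
    ... | u , u∈ , Xu≡c , X2u≢c =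
      u , (w~u , active-u , sym Xu≡c , λ e → X2u≢c (trans (sym e) Xu≡c)) , X2u≢c
      where
      w~u = ∈-nbrs⇒Adj u∈
      active-u = Active-if-unsettled (X k) _ Xu≡c X2u≢c (Adj⇒∈-nbrs (Adj-sym w~u)) refl active-w

    culprit-step : ∀ {k q w} → Culprit (suc k) q w → ∃ λ u → Culprit k w u × u ≢ q
    culprit-step {k} (_ , active-w , Xq≡Xw , unsettled) with unsettled-culprit {k} active-w unsettled
    ... | u , culprit , X2u≢Xw = u , culprit , λ { refl → X2u≢Xw Xq≡Xw }

    module _ (acyclic : Acyclic G) where

      culprit-path : ∀ k {q w} → Active G q → Culprit k q w →
                     ∃ λ p → IsPath G (q ∷ w ∷ p) × All (Active G) (q ∷ w ∷ p) × length p ≡ k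
      culprit-path zero active-q (q~w , active-w , _) =
        [] , (((Adj⇒≢ q~w ∷ []) ∷ [] ∷ []) , q~w ∷ [-]) , active-q ∷ active-w ∷ [] , refl
      culprit-path (suc k) active-q culprit@(q~w , active-w , _) with culprit-step {k} culprit
      ... | u , culprit′ , u≢q with culprit-path k active-w culprit′
      ...   | p , path , active , len =
        u ∷ p , ∷-IsPath acyclic q~w u≢q path , active-q ∷ active , cong suc len

      unsettled⇒ActivePath : ∀ s {v} → Active G v → Unsettled s v →
                             ∃ λ p → ActivePathFrom G v p × length p ≡ suc s
      unsettled⇒ActivePath zero {v} active-v _ =
        v ∷ [] , ((([] ∷ []) , [-]) , refl , active-v ∷ []) , refl
      unsettled⇒ActivePath (suc k) {v} active-v unsettled with unsettled-culprit {k} active-v unsettled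
      ... | u , culprit , _ with culprit-path k active-v culprit
      ...   | p , path , active , len = v ∷ u ∷ p , (path , refl , active) , cong (suc ∘ suc) len

claim3 : ∀ (n : ℕ) (T : Graph n) → IsTree T → AllDegreesOdd T →
           ∀ (ξ₀ : Config T) (v : Fin n) → Active T v →
           ∀ (t : ℕ) → IsLongestActivePathLength T v t →
           Stable T ξ₀ t v
claim3 n T (_ , acyclic) _ ξ₀ v active-v t (_ , longest) s t≤s _
  with majority T ξ₀ s v ≟ₛ majority T ξ₀ (2 + s) v
... | yes settled = settled
... | no unsettled with Dynamics.unsettled⇒ActivePath T ξ₀ acyclic s active-v unsettled
...   | p , active-path , len =
  contradiction (ℕP.≤-trans (subst (_≤ t) len (longest p active-path)) t≤s) (ℕP.n≮n s)
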